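{- For $n \ge 0$ let $d(n) = \sum_{k \ge 0} w(n-k,k)$ (with $w(m,k)=0$ for $m<0$). Then: (i) $d(n) = c_{ie}(n)$ for all $n \ge 0$; (ii) $\displaystyle\sum_{n \ge 0} d(n) q^n = \frac{1-q^2+q^3}{1 - q - 2 q^2 + 2 q^3}$; (iii) for $n \ge 1$, $d(n) = 2^m - 1$ if $n = 2m-1$, and $d(n) = 3\cdot 2^{m-1} - 1$ if $n = 2m$.
   Context: A composition of $n \ge 0$ is a finite sequence $(c_1,\dots,c_t)$ of positive integers with $c_1+\cdots+c_t=n$; the empty composition is the unique composition of $0$. Let $C_{12}(n)$ be the set of compositions of $n$ all of whose parts lie in $\{1,2\}$. The number of water cells of a composition $(c_1,\dots,c_t)$ is $\sum_{i=1}^{t} \max\bigl(0, \min(\max_{j \le i} c_j, \max_{j \ge i} c_j) - c_i\bigr)$ (the number of unit squares that would hold water poured over its bargraph, in which column $i$ has height $c_i$). For $n,k \ge 0$, $W(n,k)$ is the set of compositions in $C_{12}(n)$ with exactly $k$ water cells and $w(n,k)=|W(n,k)|$. $C_{ie}(n)$ is the set of compositions $(c_1,\dots,c_t)$ of $n$ such that every internal part $c_2,\dots,c_{t-1}$ is even (so all compositions with $t \le 2$ are included, including the empty composition when $n=0$), and $c_{ie}(n)=|C_{ie}(n)|$. -}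

module Defs where

open import Data.Empty using (⊥)
open import Data.Fin.Base using (Fin; toℕ)
import Data.Fin.Properties as Fin
open import Data.Integer.Base as ℤ using (ℤ; 0ℤ; 1ℤ)
import Data.Integer.Properties as ℤ
open import Data.Integer.Tactic.RingSolver using (solve-∀)
open import Data.List.Base
  using (List; []; _∷_; _++_; map; filter; foldr; length; lookup; take; drop; allFin; upTo)
open import Data.List.Membership.Propositional using (_∈_)
open import Data.List.Membership.Propositional.Properties
  using (∈-++⁺ˡ; ∈-++⁺ʳ; ∈-++⁻; ∈-map⁺; ∈-map⁻; ∈-filter⁺; ∈-filter⁻)
open import Data.List.Relation.Unary.All as All using (All; []; _∷_)
import Data.List.Relation.Unary.All.Properties as All
open import Data.List.Relation.Unary.AllPairs using ([]; _∷_)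
open import Data.List.Relation.Unary.Any using (here)
open import Data.List.Relation.Unary.Unique.Propositional using (Unique)
import Data.List.Relation.Unary.Unique.Propositional.Properties as Unique
open import Data.Nat.Base using (ℕ; zero; suc; _∸_; _⊔_; _⊓_; _≤_; _<_; z≤n; s≤s)
open import Data.Nat.Divisibility using (_∣_; _∣?_)
open import Data.Nat.ListAction using (sum)
import Data.Nat.Properties as ℕ
open import Data.Product.Base using (_×_; _,_)
open import Data.Sum.Base using (_⊎_; inj₁; inj₂)
open import Level using (0ℓ)
open import Relation.Binary.PropositionalEquality
  using (_≡_; _≗_; refl; trans; cong; cong₂; module ≡-Reasoning)
open import Relation.Nullary.Decidable using (_⊎-dec_; _→-dec_)
open import Relation.Unary using (Pred; Decidable)

-- card does not depend on the witness: two duplicate-free lists with the same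
-- members have the same length.
record Finite {A : Set} (P : Pred A 0ℓ) : Set where
  field
    elements : List A
    unique   : Unique elements
    sound    : ∀ {x} → x ∈ elements → P x
    complete : ∀ {x} → P x → x ∈ elements

  card : ℕ
  card = length elements

open Finite public using (card)

finite-∩ : {A : Set} {P Q : Pred A 0ℓ} → Finite P → Decidable Q →
           Finite (λ x → P x × Q x)
finite-∩ fin Q? = record
  { elements = filter Q? elements
  ; unique   = Unique.filter⁺ Q? unique
  ; sound    = λ x∈ → let x∈xs , qx = ∈-filter⁻ Q? x∈ in sound x∈xs , qx
  ; complete = λ (px , qx) → ∈-filter⁺ Q? (complete px) qx
  }
  where open Finite fin

Composition : ℕ → Pred (List ℕ) 0ℓ
Composition n c = All (1 ≤_) c × sum c ≡ n

C₁₂ : ℕ → Pred (List ℕ) 0ℓ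
C₁₂ n c = Composition n c × All (λ p → p ≡ 1 ⊎ p ≡ 2) c

maximum : List ℕ → ℕ
maximum = foldr _⊔_ 0

-- Truncated subtraction plays the role of max(0, _ - _).
waterAt : (c : List ℕ) → Fin (length c) → ℕ
waterAt c i =
  (maximum (take (suc (toℕ i)) c) ⊓ maximum (drop (toℕ i) c)) ∸ lookup c i

waterCells : List ℕ → ℕ
waterCells c = sum (map (waterAt c) (allFin (length c)))

W : ℕ → ℕ → Pred (List ℕ) 0ℓ
W n k c = C₁₂ n c × waterCells c ≡ k

-- Positions are counted from 0, so the internal ones are 0 < i < t ∸ 1.
InternalPartsEven : Pred (List ℕ) 0ℓ
InternalPartsEven c = (i : Fin (length c)) →
  0 < toℕ i → suc (toℕ i) < length c → 2 ∣ lookup c i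

Cᵢₑ : ℕ → Pred (List ℕ) 0ℓ
Cᵢₑ n c = Composition n c × InternalPartsEven c

incHead : List ℕ → List ℕ
incHead []       = []
incHead (c ∷ cs) = suc c ∷ cs

incHead-injective : ∀ {xs ys} → incHead xs ≡ incHead ys → xs ≡ ys
incHead-injective {[]}    {[]}    _    = refl
incHead-injective {_ ∷ _} {_ ∷ _} refl = refl

-- A composition of n + 2 either starts with 1, or arises from a
-- composition of n + 1 by increasing its first part.
compositions : ℕ → List (List ℕ)
compositions zero          = [] ∷ []
compositions (suc zero)    = (1 ∷ []) ∷ []
compositions (suc (suc n)) =
  map (1 ∷_) (compositions (suc n)) ++ map incHead (compositions (suc n))

compositions-sound : ∀ n → All (Composition n) (compositions n)
compositions-sound zero          = ([] , refl) ∷ []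
compositions-sound (suc zero)    = ((s≤s z≤n ∷ []) , refl) ∷ []
compositions-sound (suc (suc n)) = All.++⁺
  (All.map⁺ (All.map prepend (compositions-sound (suc n))))
  (All.map⁺ (All.map increase (compositions-sound (suc n))))
  where
  prepend : ∀ {c} → Composition (suc n) c → Composition (suc (suc n)) (1 ∷ c)
  prepend (pos , eq) = (s≤s z≤n ∷ pos) , cong suc eq
  increase : ∀ {c} → Composition (suc n) c →
             Composition (suc (suc n)) (incHead c)
  increase {_ ∷ _} ((_ ∷ pos) , eq) = (s≤s z≤n ∷ pos) , cong suc eq

compositions-complete : ∀ n {c} → Composition n c → c ∈ compositions n
compositions-complete zero {[]}                ([] , refl)      = here refl
compositions-complete zero {zero ∷ _}          ((() ∷ _) , _)
compositions-complete (suc n) {zero ∷ _}       ((() ∷ _) , _)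
compositions-complete (suc zero) {suc zero ∷ []} _              = here refl
compositions-complete (suc zero) {suc zero ∷ zero ∷ _} ((_ ∷ () ∷ _) , _)
compositions-complete (suc (suc n)) {suc zero ∷ _} ((_ ∷ pos) , eq) =
  ∈-++⁺ˡ (∈-map⁺ (1 ∷_)
    (compositions-complete (suc n) (pos , ℕ.suc-injective eq)))
compositions-complete (suc (suc n)) {suc (suc _) ∷ _} ((_ ∷ pos) , eq) =
  ∈-++⁺ʳ (map (1 ∷_) (compositions (suc n))) (∈-map⁺ incHead
    (compositions-complete (suc n) ((s≤s z≤n ∷ pos) , ℕ.suc-injective eq)))

compositions-disjoint : ∀ n {c} → c ∈ map (1 ∷_) (compositions (suc n)) ×
                        c ∈ map incHead (compositions (suc n)) → ⊥
compositions-disjoint n (c∈₁ , c∈₂)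
  with ∈-map⁻ (1 ∷_) c∈₁ | ∈-map⁻ incHead c∈₂
... | _ , _ , refl | b , b∈ , eq with b | All.lookup (compositions-sound (suc n)) b∈
...   | suc _ ∷ _ | _ with () ← eq
...   | zero  ∷ _ | (() ∷ _) , _

compositions-unique : ∀ n → Unique (compositions n)
compositions-unique zero          = [] ∷ []
compositions-unique (suc zero)    = [] ∷ []
compositions-unique (suc (suc n)) = Unique.++⁺
  (Unique.map⁺ (λ { refl → refl }) (compositions-unique (suc n)))
  (Unique.map⁺ incHead-injective (compositions-unique (suc n)))
  (compositions-disjoint n)

Composition-finite : ∀ n → Finite (Composition n)
Composition-finite n = record
  { elements = compositions n
  ; unique   = compositions-unique n
  ; sound    = All.lookup (compositions-sound n)
  ; complete = compositions-complete n
  }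

C₁₂-finite : ∀ n → Finite (C₁₂ n)
C₁₂-finite n = finite-∩ (Composition-finite n)
  (All.all? (λ p → (p ℕ.≟ 1) ⊎-dec (p ℕ.≟ 2)))

W-finite : ∀ n k → Finite (W n k)
W-finite n k = finite-∩ (C₁₂-finite n) (λ c → waterCells c ℕ.≟ k)

internalPartsEven? : Decidable InternalPartsEven
internalPartsEven? c = Fin.all? λ i →
  (0 ℕ.<? toℕ i) →-dec ((suc (toℕ i) ℕ.<? length c) →-dec (2 ∣? lookup c i))

Cᵢₑ-finite : ∀ n → Finite (Cᵢₑ n)
Cᵢₑ-finite n = finite-∩ (Composition-finite n) internalPartsEven?

w : ℕ → ℕ → ℕ
w n k = card (W-finite n k)

cᵢₑ : ℕ → ℕ
cᵢₑ n = card (Cᵢₑ-finite n)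

-- d n is the sum over all k ≥ 0 of w (n - k) k. The terms with k > n are 0
-- by the convention w(m,k) = 0 for m < 0, so k ranges over 0, …, n, where
-- n ∸ k is the true difference.
d : ℕ → ℕ
d n = sum (map (λ k → w (n ∸ k) k) (upTo (suc n)))

-- Formal power series in q over ℤ, as coefficient sequences.
PowerSeries : Set
PowerSeries = ℕ → ℤ

-- Coefficients are listed constant term first.
poly : List ℤ → PowerSeries
poly []       _       = 0ℤ
poly (a ∷ _)  zero    = a
poly (_ ∷ as) (suc n) = poly as n

-- t 0 + ⋯ + t n, both ends included
Σ≤ : ℕ → (ℕ → ℤ) → ℤ
Σ≤ zero    t = t 0
Σ≤ (suc n) t = t 0 ℤ.+ Σ≤ n (λ i → t (suc i))

infixl 7 _⊛_

_⊛_ : PowerSeries → PowerSeries → PowerSeries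
(f ⊛ g) n = Σ≤ n (λ i → f i ℤ.* g (n ∸ i))

-- Long division of f by a series g with constant term 1. The quotient is
-- f₀ + q · h, where h is the quotient of (f - f₀ g) / q by g.
quotient : (f g : PowerSeries) → g 0 ≡ 1ℤ → PowerSeries
quotient f g g₀≡1 zero    = f 0
quotient f g g₀≡1 (suc n) =
  quotient (λ i → f (suc i) ℤ.- f 0 ℤ.* g (suc i)) g g₀≡1 n

quotient-correct : ∀ f g (g₀≡1 : g 0 ≡ 1ℤ) → quotient f g g₀≡1 ⊛ g ≗ f
quotient-correct f g g₀≡1 zero =
  trans (cong (f 0 ℤ.*_) g₀≡1) (ℤ.*-identityʳ (f 0))
quotient-correct f g g₀≡1 (suc n) = begin
  f 0 ℤ.* g (suc n) ℤ.+ (quotient f′ g g₀≡1 ⊛ g) n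
    ≡⟨ cong (λ z → f 0 ℤ.* g (suc n) ℤ.+ z) (quotient-correct f′ g g₀≡1 n) ⟩
  f 0 ℤ.* g (suc n) ℤ.+ (f (suc n) ℤ.- f 0 ℤ.* g (suc n))
    ≡⟨ lemma (f 0 ℤ.* g (suc n)) (f (suc n)) ⟩
  f (suc n) ∎
  where
  open ≡-Reasoning
  f′ : PowerSeries
  f′ i = f (suc i) ℤ.- f 0 ℤ.* g (suc i)
  lemma : ∀ x y → x ℤ.+ (y ℤ.- x) ≡ y
  lemma = solve-∀

quotient-unique : ∀ h f g (g₀≡1 : g 0 ≡ 1ℤ) → h ⊛ g ≗ f → h ≗ quotient f g g₀≡1
quotient-unique h f g g₀≡1 hg≗f = go
  where
  open ≡-Reasoning
  h₀≡f₀ : h 0 ≡ f 0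
  h₀≡f₀ = begin
    h 0           ≡⟨ ℤ.*-identityʳ (h 0) ⟨
    h 0 ℤ.* 1ℤ    ≡⟨ cong (h 0 ℤ.*_) g₀≡1 ⟨
    h 0 ℤ.* g 0   ≡⟨ hg≗f 0 ⟩
    f 0           ∎
  lemma : ∀ x y → y ≡ (x ℤ.+ y) ℤ.- x
  lemma = solve-∀
  tail-eq : ∀ n → ((λ i → h (suc i)) ⊛ g) n ≡ f (suc n) ℤ.- f 0 ℤ.* g (suc n)
  tail-eq n = trans (lemma (h 0 ℤ.* g (suc n)) _)
    (cong₂ ℤ._-_ (hg≗f (suc n)) (cong (ℤ._* g (suc n)) h₀≡f₀))
  go : h ≗ quotient f g g₀≡1
  go zero    = h₀≡f₀
  go (suc n) = quotient-unique (λ i → h (suc i)) _ g g₀≡1 tail-eq n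

generatingFunction : (ℕ → ℕ) → PowerSeries
generatingFunction a n = ℤ.+ a n

-- Water collects exactly in the 1s lying between two 2s. So for the weight
-- sum + water, a composition with parts 1 and 2 is 1ᵃ, or 1ᵃ 2 followed by a
-- word r in which every letter up to the last 2 weighs two and each of the
-- final 1s weighs one. If t n counts the words r of weight n, then
-- t (n + 2) = 2 t n, and splitting off the first part gives
-- d (n + 2) = d (n + 1) + t n. The compositions with even internal parts
-- satisfy the same recurrence: either the first part is 1, and what remains
-- is a composition of n + 1 whose parts other than the last are even (there
-- are t n of these), or the first part can be decreased.
module Submission where

open import Defs
open import Data.Empty using (⊥; ⊥-elim)
open import Data.Fin.Base using (Fin; zero; suc; toℕ)
open import Data.Integer.Base as ℤ using (ℤ; +_; -_; 0ℤ)
import Data.Integer.Properties as ℤ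
open import Data.Integer.Tactic.RingSolver using (solve-∀)
open import Data.List.Base
  using (List; []; _∷_; _++_; map; concat; length; lookup; take; drop; replicate; allFin; upTo)
open import Data.List.Membership.Propositional using (_∈_)
open import Data.List.Membership.Propositional.Properties
  using (∈-++⁺ˡ; ∈-++⁺ʳ; ∈-++⁻; ∈-map⁺; ∈-map⁻; ∈-concat⁺′; ∈-concat⁻′; ∈-upTo⁺; ∈-upTo⁻)
open import Data.List.Properties
  using (∷-injectiveʳ; length-++; length-map; map-cong; map-∘; map-tabulate)
open import Data.List.Relation.Binary.BagAndSetEquality using (∼bag⇒↭)
open import Data.List.Relation.Binary.Disjoint.Propositional using (Disjoint)
open import Data.List.Relation.Binary.Permutation.Propositional.Properties using (↭-length)
open import Data.List.Membership.Propositional.Properties.WithK using (unique∧set⇒bag)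
open import Data.List.Relation.Unary.All as All using (All; []; _∷_)
import Data.List.Relation.Unary.All.Properties as All
import Data.List.Relation.Unary.AllPairs as AllPairs
import Data.List.Relation.Unary.AllPairs.Properties as AllPairs
open import Data.List.Relation.Unary.AllPairs using ([]; _∷_)
open import Data.List.Relation.Unary.Any using (here)
import Data.List.Relation.Unary.Unique.Propositional.Properties as Unique
open import Data.Nat.Base
  using (ℕ; zero; suc; _+_; _*_; _∸_; _^_; _⊔_; _⊓_; _≤_; _<_; z≤n; s≤s)
open import Data.Nat.Divisibility using (_∣_; ∣-refl; ∣m∣n⇒∣m+n; ∣m+n∣m⇒∣n; >⇒∤)
open import Data.Nat.ListAction using (sum)
import Data.Nat.Properties as ℕ
import Data.Nat.Tactic.RingSolver as ℕ-Solver
open import Data.Product.Base using (_×_; _,_; proj₁; ∃)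
open import Data.Sum.Base using (_⊎_; inj₁; inj₂)
open import Function.Base using (_∘_; id)
open import Function.Bundles using (mk⇔)
open import Level using (0ℓ)
open import Relation.Binary.PropositionalEquality
  using (_≡_; _≢_; _≗_; refl; sym; trans; cong; cong₂; subst; module ≡-Reasoning)
open import Relation.Unary using (Pred; _⊆_)

private variable
  A B C : Set

-- Finite predicates

-- Set equality of duplicate-free lists is bag equality, hence a permutation, which keeps the
-- length. A count may thus be computed from a recursive enumeration instead of a filtered one.
card-cong : {P Q : Pred A 0ℓ} (finP : Finite P) (finQ : Finite Q) →
            P ⊆ Q → Q ⊆ P → card finP ≡ card finQ
card-cong finP finQ P⊆Q Q⊆P = ↭-length (∼bag⇒↭ (unique∧set⇒bag
  (Finite.unique finP) (Finite.unique finQ)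
  (mk⇔ (Finite.complete finQ ∘ P⊆Q ∘ Finite.sound finP)
       (Finite.complete finP ∘ Q⊆P ∘ Finite.sound finQ))))

finite-∅ : {P : Pred A 0ℓ} → (∀ {x} → P x → ⊥) → Finite P
finite-∅ ¬P = record
  { elements = []
  ; unique   = []
  ; sound    = λ ()
  ; complete = λ px → ⊥-elim (¬P px)
  }

finite-singleton : {P : Pred A 0ℓ} (x : A) → P x → (∀ {y} → P y → y ≡ x) → Finite P
finite-singleton x px only = record
  { elements = x ∷ []
  ; unique   = [] ∷ []
  ; sound    = λ { (here refl) → px }
  ; complete = λ py → here (only py)
  }

-- The form of every recurrence below: `R` splits into an image of `P` and an image of `Q`.
-- Disjointness is asked only for members of `P` and `Q`, because `incHead` of a list starting with
-- 0 starts with 1.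
finite-⊎ : {P : Pred A 0ℓ} {Q : Pred B 0ℓ} {R : Pred C 0ℓ} (f : A → C) (g : B → C) →
           Finite P → Finite Q →
           (∀ {x y} → f x ≡ f y → x ≡ y) → (∀ {x y} → g x ≡ g y → x ≡ y) →
           (∀ {x y} → P x → Q y → f x ≢ g y) →
           (∀ {x} → P x → R (f x)) → (∀ {y} → Q y → R (g y)) →
           (∀ {z} → R z → (∃ λ x → P x × z ≡ f x) ⊎ (∃ λ y → Q y × z ≡ g y)) →
           Finite R
finite-⊎ {R = R} f g finP finQ f-injective g-injective f≢g P⇒R Q⇒R R⇒ = record
  { elements = map f (elements finP) ++ map g (elements finQ)
  ; unique   = Unique.++⁺ (Unique.map⁺ f-injective (unique finP))
                 (Unique.map⁺ g-injective (unique finQ)) disjoint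
  ; sound    = sound′
  ; complete = complete′
  }
  where
  open Finite
  disjoint : ∀ {z} → z ∈ map f (elements finP) × z ∈ map g (elements finQ) → ⊥
  disjoint (z∈₁ , z∈₂) with ∈-map⁻ f z∈₁ | ∈-map⁻ g z∈₂
  ... | _ , x∈ , refl | _ , y∈ , eq = f≢g (sound finP x∈) (sound finQ y∈) eq
  sound′ : ∀ {z} → z ∈ map f (elements finP) ++ map g (elements finQ) → R z
  sound′ z∈ with ∈-++⁻ (map f (elements finP)) z∈
  ... | inj₁ z∈₁ with _ , x∈ , refl ← ∈-map⁻ f z∈₁ = P⇒R (sound finP x∈)
  ... | inj₂ z∈₂ with _ , y∈ , refl ← ∈-map⁻ g z∈₂ = Q⇒R (sound finQ y∈)
  complete′ : ∀ {z} → R z → z ∈ map f (elements finP) ++ map g (elements finQ)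
  complete′ rz with R⇒ rz
  ... | inj₁ (_ , px , refl) = ∈-++⁺ˡ (∈-map⁺ f (complete finP px))
  ... | inj₂ (_ , qy , refl) = ∈-++⁺ʳ (map f (elements finP)) (∈-map⁺ g (complete finQ qy))

length-maps : (f : A → C) (g : B → C) (xs : List A) (ys : List B) →
              length (map f xs ++ map g ys) ≡ length xs + length ys
length-maps f g xs ys = trans (length-++ (map f xs)) (cong₂ _+_ (length-map f xs) (length-map g ys))

length-concat : (xss : List (List A)) → length (concat xss) ≡ sum (map length xss)
length-concat []         = refl
length-concat (xs ∷ xss) = trans (length-++ xs) (cong (_+_ (length xs)) (length-concat xss))

finite-⋃ : {P : ℕ → Pred A 0ℓ} → (∀ k → Finite (P k)) →
           (∀ {i j x} → P i x → P j x → i ≡ j) →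
           ∀ N → Finite (λ x → ∃ λ k → k < N × P k x)
finite-⋃ {P = P} fin functional N = record
  { elements = concat (map elems (upTo N))
  ; unique   = Unique.concat⁺ (All.map⁺ (All.universal (λ k → Finite.unique (fin k)) (upTo N)))
                 (AllPairs.map⁺ (AllPairs.map disjoint (Unique.upTo⁺ N)))
  ; sound    = sound′
  ; complete = λ (k , k<N , px) → ∈-concat⁺′ (Finite.complete (fin k) px)
                 (∈-map⁺ elems (∈-upTo⁺ k<N))
  }
  where
  sound : ∀ k {x} → x ∈ Finite.elements (fin k) → P k x
  sound k = Finite.sound (fin k)
  elems = λ k → Finite.elements (fin k)
  disjoint : ∀ {i j} → i ≢ j → Disjoint (elems i) (elems j)
  disjoint i≢j (x∈ , x∈′) = i≢j (functional (sound _ x∈) (sound _ x∈′))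
  sound′ : ∀ {x} → x ∈ concat (map elems (upTo N)) → ∃ λ k → k < N × P k x
  sound′ x∈ with ∈-concat⁻′ (map elems (upTo N)) x∈
  ... | _ , x∈xs , xs∈ with k , k∈ , refl ← ∈-map⁻ elems xs∈ = k , ∈-upTo⁻ k∈ , sound k x∈xs

card-⋃ : {P : ℕ → Pred A 0ℓ} (fin : ∀ k → Finite (P k))
         (functional : ∀ {i j x} → P i x → P j x → i ≡ j) (N : ℕ) →
         card (finite-⋃ {P = P} fin functional N) ≡ sum (map (λ k → card (fin k)) (upTo N))
card-⋃ fin functional N =
  trans (length-concat (map (λ k → Finite.elements (fin k)) (upTo N)))
        (cong sum (sym (map-∘ (upTo N))))

-- The common recurrence

-- This is 2 to the power ⌊n/2⌋.
tails : ℕ → ℕ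
tails zero          = 1
tails (suc zero)    = 1
tails (suc (suc n)) = tails n + tails n

total : ℕ → ℕ
total zero          = 1
total (suc zero)    = 1
total (suc (suc n)) = tails n + total (suc n)

-- Water cells of compositions with parts 1 and 2

OneOrTwo : Pred ℕ 0ℓ
OneOrTwo p = p ≡ 1 ⊎ p ≡ 2

-- The water held when a wall of maximal height is put to the left.
pool : List ℕ → ℕ
pool []      = 0
pool (x ∷ c) = (maximum (x ∷ c) ∸ x) + pool c

maximum-≤ : ∀ {m c} → All (_≤ m) c → maximum c ≤ m
maximum-≤ []          = z≤n
maximum-≤ (x≤m ∷ c≤m) = ℕ.⊔-lub x≤m (maximum-≤ c≤m)

OneOrTwo⇒1≤ : ∀ {p} → OneOrTwo p → 1 ≤ p
OneOrTwo⇒1≤ (inj₁ refl) = s≤s z≤n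
OneOrTwo⇒1≤ (inj₂ refl) = s≤s z≤n

OneOrTwo⇒≤2 : ∀ {p} → OneOrTwo p → p ≤ 2
OneOrTwo⇒≤2 (inj₁ refl) = s≤s z≤n
OneOrTwo⇒≤2 (inj₂ refl) = s≤s (s≤s z≤n)

maximum≤2 : ∀ {c} → All OneOrTwo c → maximum c ≤ 2
maximum≤2 ps = maximum-≤ (All.map OneOrTwo⇒≤2 ps)

map-allFin-suc : ∀ {n} (f : Fin (suc n) → A) →
                 map f (allFin (suc n)) ≡ f zero ∷ map (f ∘ suc) (allFin n)
map-allFin-suc f = cong (f zero ∷_) (trans (map-tabulate suc f) (sym (map-tabulate id (f ∘ suc))))

-- The first column holds no water, since the maximum up to it is its own height.
waterCells-∷ : ∀ x c →
  waterCells (x ∷ c) ≡ sum (map (λ i → waterAt (x ∷ c) (suc i)) (allFin (length c)))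
waterCells-∷ x c = trans (cong sum (map-allFin-suc (waterAt (x ∷ c))))
  (cong (_+ sum (map (λ i → waterAt (x ∷ c) (suc i)) (allFin (length c)))) no-water)
  where
  no-water : waterAt (x ∷ c) zero ≡ 0
  no-water = ℕ.m≤n⇒m∸n≡0 (ℕ.≤-trans (ℕ.m⊓n≤m (x ⊔ 0) _) (ℕ.≤-reflexive (ℕ.⊔-identityʳ x)))

-- A leading 1 changes no left maximum, as these are all at least 1 already.
waterCells-1∷ : ∀ {c} → All (1 ≤_) c → waterCells (1 ∷ c) ≡ waterCells c
waterCells-1∷ {c} 1≤c = trans (waterCells-∷ 1 c)
  (cong sum (map-cong (λ i → cong (λ m → (m ⊓ maximum (drop (toℕ i) c)) ∸ lookup c i)
    (ℕ.m≤n⇒m⊔n≡n (1≤maximum-take 1≤c i))) (allFin (length c))))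
  where
  1≤maximum-take : ∀ {c} → All (1 ≤_) c → (i : Fin (length c)) →
                   1 ≤ maximum (take (suc (toℕ i)) c)
  1≤maximum-take {x ∷ _} (1≤x ∷ _) i = ℕ.≤-trans 1≤x (ℕ.m≤m⊔n x _)

pool-sum : ∀ c →
  sum (map (λ i → maximum (drop (toℕ i) c) ∸ lookup c i) (allFin (length c))) ≡ pool c
pool-sum []      = refl
pool-sum (x ∷ c) = trans
  (cong sum (map-allFin-suc (λ i → maximum (drop (toℕ i) (x ∷ c)) ∸ lookup (x ∷ c) i)))
  (cong (_+_ (maximum (x ∷ c) ∸ x)) (pool-sum c))

-- Behind a 2 every left maximum is 2, so the right maximum alone decides the water level.
waterCells-2∷ : ∀ {c} → All (_≤ 2) c → waterCells (2 ∷ c) ≡ pool c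
waterCells-2∷ {c} c≤2 = trans (waterCells-∷ 2 c)
  (trans (cong sum (map-cong (λ i → cong (_∸ lookup c i) (trans
    (cong (_⊓ maximum (drop (toℕ i) c))
      (ℕ.m≥n⇒m⊔n≡m (maximum-≤ (All.take⁺ (suc (toℕ i)) c≤2))))
    (ℕ.m≥n⇒m⊓n≡n (maximum-≤ (All.drop⁺ (toℕ i) c≤2))))) (allFin (length c))))
  (pool-sum c))

-- Words behind the first 2, counted by weight

weight : List ℕ → ℕ
weight c = sum c + pool c

weight-2∷ : ∀ {c} → All OneOrTwo c → weight (2 ∷ c) ≡ 2 + weight c
weight-2∷ ps rewrite ℕ.m≥n⇒m⊔n≡m (maximum≤2 ps) = refl

-- The 1 has a 2 to its right and so carries one unit of water.
weight-1∷ : ∀ {c} → maximum c ≡ 2 → weight (1 ∷ c) ≡ 2 + weight c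
weight-1∷ {c} max≡2 rewrite max≡2 = cong suc (ℕ.+-suc (sum c) (pool c))

maximum-ones : ∀ n → maximum (replicate n 1) ≤ 1
maximum-ones n = maximum-≤ (All.replicate⁺ n ℕ.≤-refl)

weight-ones : ∀ n → weight (replicate n 1) ≡ n
weight-ones zero    = refl
weight-ones (suc n) rewrite ℕ.m≥n⇒m⊔n≡m (maximum-ones n) = cong suc (weight-ones n)

ones-or-maximum≡2 : ∀ {c} → All OneOrTwo c → c ≡ replicate (length c) 1 ⊎ maximum c ≡ 2
ones-or-maximum≡2 [] = inj₁ refl
ones-or-maximum≡2 (inj₂ refl ∷ ps) = inj₂ (ℕ.m≥n⇒m⊔n≡m (maximum≤2 ps))
ones-or-maximum≡2 (inj₁ refl ∷ ps) with ones-or-maximum≡2 ps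
... | inj₁ c≡ones = inj₁ (cong (1 ∷_) c≡ones)
... | inj₂ max≡2  = inj₂ (cong (1 ⊔_) max≡2)

maximum≤sum : ∀ c → maximum c ≤ sum c
maximum≤sum []      = z≤n
maximum≤sum (x ∷ c) =
  ℕ.⊔-lub (ℕ.m≤m+n x (sum c)) (ℕ.≤-trans (maximum≤sum c) (ℕ.m≤n+m (sum c) x))

T : ℕ → Pred (List ℕ) 0ℓ
T n c = All OneOrTwo c × weight c ≡ n

T₂ : ℕ → Pred (List ℕ) 0ℓ
T₂ n c = T n c × maximum c ≡ 2

T₂⇒2≤ : ∀ {n c} → T₂ n c → 2 ≤ n
T₂⇒2≤ {n} {c} ((_ , w≡n) , max≡2) =
  subst (2 ≤_) w≡n (ℕ.≤-trans (subst (_≤ sum c) max≡2 (maximum≤sum c)) (ℕ.m≤m+n _ _))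

-- Mutual recursion in steps of two. A word with a 2 is either a 2 before any word or a 1 before a
-- word with a 2, and both letters weigh two. Apart from these, `T n` contains only the word of n
-- ones.
T₂-finite : ∀ n → Finite (T₂ n)
T-finite  : ∀ n → Finite (T n)

T₂-finite zero          = finite-∅ (ℕ.<⇒≱ (s≤s z≤n) ∘ T₂⇒2≤)
T₂-finite (suc zero)    = finite-∅ (ℕ.<⇒≱ (s≤s (s≤s z≤n)) ∘ T₂⇒2≤)
T₂-finite (suc (suc n)) =
  finite-⊎ (2 ∷_) (1 ∷_) (T-finite n) (T₂-finite n) ∷-injectiveʳ ∷-injectiveʳ
    (λ _ _ ()) prepend-2 prepend-1 split
  where
  prepend-2 : ∀ {c} → T n c → T₂ (suc (suc n)) (2 ∷ c)
  prepend-2 (ps , w≡n) =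
    (inj₂ refl ∷ ps , trans (weight-2∷ ps) (cong (_+_ 2) w≡n)) , ℕ.m≥n⇒m⊔n≡m (maximum≤2 ps)
  prepend-1 : ∀ {c} → T₂ n c → T₂ (suc (suc n)) (1 ∷ c)
  prepend-1 {c} ((ps , w≡n) , max≡2) =
    (inj₁ refl ∷ ps , trans (weight-1∷ {c} max≡2) (cong (_+_ 2) w≡n)) , cong (1 ⊔_) max≡2
  maximum-1∷⁻ : ∀ {m} → 1 ⊔ m ≡ 2 → m ≡ 2
  maximum-1∷⁻ {suc _} eq = eq
  split : ∀ {c} → T₂ (suc (suc n)) c →
          (∃ λ c′ → T n c′ × c ≡ 2 ∷ c′) ⊎ (∃ λ c′ → T₂ n c′ × c ≡ 1 ∷ c′)
  split {_ ∷ c} ((inj₂ refl ∷ ps , w≡) , _) =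
    inj₁ (c , (ps , ℕ.+-cancelˡ-≡ 2 _ _ (trans (sym (weight-2∷ ps)) w≡)) , refl)
  split {_ ∷ c} ((inj₁ refl ∷ ps , w≡) , max≡2) =
    inj₂ (c , ((ps , ℕ.+-cancelˡ-≡ 2 _ _ (trans (sym (weight-1∷ {c} max′≡2)) w≡)) , max′≡2)
         , refl)
    where max′≡2 = maximum-1∷⁻ max≡2

T-finite n =
  finite-⊎ id id (finite-singleton {P = _≡ replicate n 1} (replicate n 1) refl id) (T₂-finite n)
    id id disjoint
    (λ { refl → All.replicate⁺ n (inj₁ refl) , weight-ones n }) proj₁ split
  where
  disjoint : ∀ {c c′} → c ≡ replicate n 1 → T₂ n c′ → c ≢ c′
  disjoint refl (_ , max≡2) refl with s≤s () ← subst (_≤ 1) max≡2 (maximum-ones n)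
  split : ∀ {c} → T n c →
          (∃ λ c′ → c′ ≡ replicate n 1 × c ≡ c′) ⊎ (∃ λ c′ → T₂ n c′ × c ≡ c′)
  split {c} (ps , w≡n) with ones-or-maximum≡2 ps
  ... | inj₂ max≡2  = inj₂ (c , ((ps , w≡n) , max≡2) , refl)
  ... | inj₁ c≡ones = inj₁ (c , trans c≡ones (cong (λ k → replicate k 1) length≡n) , refl)
    where
    length≡n : length c ≡ n
    length≡n = trans (sym (weight-ones (length c))) (trans (cong weight (sym c≡ones)) w≡n)

-- The all-ones word of weight n + 2 supplies the unit that completes the count of `T₂ n` to that of
-- `T n`; hence the doubling.
card-T     : ∀ n → card (T-finite n) ≡ tails n
card-T-suc : ∀ n → card (T-finite n) ≡ suc (card (T₂-finite n))

card-T-suc n = length-maps id id (replicate n 1 ∷ []) (Finite.elements (T₂-finite n))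

card-T zero          = refl
card-T (suc zero)    = refl
card-T (suc (suc n)) = begin
  card (T-finite (suc (suc n)))                     ≡⟨ card-T-suc (suc (suc n)) ⟩
  suc (card (T₂-finite (suc (suc n))))
    ≡⟨ cong suc (length-maps (2 ∷_) (1 ∷_) (Finite.elements (T-finite n)) _) ⟩
  suc (card (T-finite n) + card (T₂-finite n))
    ≡⟨ ℕ.+-suc (card (T-finite n)) _ ⟨
  card (T-finite n) + suc (card (T₂-finite n))
    ≡⟨ cong (_+_ (card (T-finite n))) (card-T-suc n) ⟨
  card (T-finite n) + card (T-finite n)             ≡⟨ cong₂ _+_ (card-T n) (card-T n) ⟩
  tails n + tails n                                 ∎
  where open ≡-Reasoning

-- Compositions counted by sum plus water

D : ℕ → Pred (List ℕ) 0ℓ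
D n c = All OneOrTwo c × sum c + waterCells c ≡ n

sum+waterCells-1∷ : ∀ {c} → All OneOrTwo c →
       sum (1 ∷ c) + waterCells (1 ∷ c) ≡ suc (sum c + waterCells c)
sum+waterCells-1∷ {c} ps = cong (λ k → suc (sum c + k)) (waterCells-1∷ (All.map OneOrTwo⇒1≤ ps))

sum+waterCells-2∷ : ∀ {c} → All OneOrTwo c → sum (2 ∷ c) + waterCells (2 ∷ c) ≡ 2 + weight c
sum+waterCells-2∷ {c} ps = cong (λ k → 2 + (sum c + k)) (waterCells-2∷ (All.map OneOrTwo⇒≤2 ps))

D-zero : ∀ {c} → D 0 c → c ≡ []
D-zero {[]}    _                    = refl
D-zero {_ ∷ _} (inj₁ refl ∷ _ , ())
D-zero {_ ∷ _} (inj₂ refl ∷ _ , ())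

-- After a leading 2 the rest is measured by `weight` and ranges over `T`; a leading 1 just adds one
-- to sum plus water.
D-finite : ∀ n → Finite (D n)
D-finite zero          = finite-singleton [] ([] , refl) D-zero
D-finite (suc zero)    = finite-singleton (1 ∷ []) (inj₁ refl ∷ [] , refl) only
  where
  only : ∀ {c} → D 1 c → c ≡ 1 ∷ []
  only {[]}    (_ , ())
  only {_ ∷ _} (inj₂ refl ∷ _ , ())
  only {_ ∷ _} (inj₁ refl ∷ ps , eq) =
    cong (1 ∷_) (D-zero (ps , ℕ.suc-injective (trans (sym (sum+waterCells-1∷ ps)) eq)))
D-finite (suc (suc n)) =
  finite-⊎ (2 ∷_) (1 ∷_) (T-finite n) (D-finite (suc n)) ∷-injectiveʳ ∷-injectiveʳ
    (λ _ _ ())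
    (λ (ps , eq) → inj₂ refl ∷ ps , trans (sum+waterCells-2∷ ps) (cong (_+_ 2) eq))
    (λ (ps , eq) → inj₁ refl ∷ ps , trans (sum+waterCells-1∷ ps) (cong suc eq))
    split
  where
  split : ∀ {c} → D (suc (suc n)) c →
          (∃ λ c′ → T n c′ × c ≡ 2 ∷ c′) ⊎ (∃ λ c′ → D (suc n) c′ × c ≡ 1 ∷ c′)
  split {[]}    (_ , ())
  split {_ ∷ c} (inj₂ refl ∷ ps , eq) =
    inj₁ (c , (ps , ℕ.+-cancelˡ-≡ 2 _ _ (trans (sym (sum+waterCells-2∷ ps)) eq)) , refl)
  split {_ ∷ c} (inj₁ refl ∷ ps , eq) =
    inj₂ (c , (ps , ℕ.suc-injective (trans (sym (sum+waterCells-1∷ ps)) eq)) , refl)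

card-D : ∀ n → card (D-finite n) ≡ total n
card-D zero          = refl
card-D (suc zero)    = refl
card-D (suc (suc n)) = trans
  (length-maps (2 ∷_) (1 ∷_) (Finite.elements (T-finite n)) _)
  (cong₂ _+_ (card-T n) (card-D (suc n)))

-- The sets `W (n ∸ k) k` are disjoint, because a composition determines its number of water cells,
-- and their union over k ≤ n is `D n`.
d≡total : ∀ n → d n ≡ total n
d≡total n = trans
  (sym (card-⋃ (λ k → W-finite (n ∸ k) k) functional (suc n)))
  (trans (card-cong (finite-⋃ (λ k → W-finite (n ∸ k) k) functional (suc n)) (D-finite n)
            to from)
         (card-D n))
  where
  functional : ∀ {i j c} → W (n ∸ i) i c → W (n ∸ j) j c → i ≡ j
  functional (_ , w≡i) (_ , w≡j) = trans (sym w≡i) w≡j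
  to : ∀ {c} → (∃ λ k → k < suc n × W (n ∸ k) k c) → D n c
  to (k , s≤s k≤n , ((_ , sum≡) , ps) , w≡k) =
    ps , trans (cong₂ _+_ sum≡ w≡k) (ℕ.m∸n+n≡m k≤n)
  from : ∀ {c} → D n c → ∃ λ k → k < suc n × W (n ∸ k) k c
  from {c} (ps , eq) =
    -- The witness k is the water itself; it is at most n, being a summand of n.
    waterCells c , s≤s (subst (waterCells c ≤_) eq (ℕ.m≤n+m _ (sum c))) ,
    ((All.map OneOrTwo⇒1≤ ps ,
      trans (sym (ℕ.m+n∸n≡m (sum c) (waterCells c))) (cong (_∸ waterCells c) eq)) , ps) , refl

-- Compositions with even internal parts

-- The condition left on the remaining parts once the first part of a composition in `Cᵢₑ` is
-- removed.
InitEven : Pred (List ℕ) 0ℓ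
InitEven c = (i : Fin (length c)) → suc (toℕ i) < length c → 2 ∣ lookup c i

-- The index is shifted so that the empty composition does not occur.
U : ℕ → Pred (List ℕ) 0ℓ
U n c = Composition (suc n) c × InitEven c

¬2∣1 : 2 ∣ 1 → ⊥
¬2∣1 = >⇒∤ (s≤s (s≤s z≤n))

¬InitEven-1∷ : ∀ {x c} → InitEven (1 ∷ x ∷ c) → ⊥
¬InitEven-1∷ even = ¬2∣1 (even zero (s≤s (s≤s z≤n)))

Composition-zero : ∀ {c} → Composition 0 c → c ≡ []
Composition-zero {[]}    _               = refl
Composition-zero {_ ∷ _} (s≤s _ ∷ _ , ())

Composition-one : ∀ {c} → Composition 1 c → c ≡ 1 ∷ []
Composition-one {[]}           (_ , ())
Composition-one {zero ∷ _}     (() ∷ _ , _)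
Composition-one {suc zero ∷ _} (_ ∷ pos , eq) =
  cong (1 ∷_) (Composition-zero (pos , ℕ.suc-injective eq))

-- For sums of at least 3, a first part 1 would be a non-last odd part. A first part 2 can be
-- deleted, and a larger one lowered by 2 without changing its parity.
U-finite : ∀ n → Finite (U n)
U-finite zero = finite-singleton (1 ∷ []) ((s≤s z≤n ∷ [] , refl) , λ { zero (s≤s ()) })
    (Composition-one ∘ proj₁)
U-finite (suc zero) = finite-singleton (2 ∷ []) ((s≤s z≤n ∷ [] , refl) , λ { zero (s≤s ()) }) only
  where
  only : ∀ {c} → U 1 c → c ≡ 2 ∷ []
  only {[]} ((_ , ()) , _)
  only {zero ∷ _} ((() ∷ _ , _) , _)
  only {suc zero ∷ []} ((_ , ()) , _)
  only {suc zero ∷ _ ∷ _} (_ , even) = ⊥-elim (¬InitEven-1∷ even)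
  only {suc (suc zero) ∷ _} ((_ ∷ pos , eq) , _) =
    cong (2 ∷_) (Composition-zero (pos , ℕ.+-cancelˡ-≡ 2 _ _ eq))
U-finite (suc (suc n)) =
  finite-⊎ (2 ∷_) (incHead ∘ incHead) (U-finite n) (U-finite n)
    ∷-injectiveʳ (incHead-injective ∘ incHead-injective) disjoint prepend increase split
  where
  disjoint : ∀ {c c′} → U n c → U n c′ → 2 ∷ c ≢ incHead (incHead c′)
  -- Positivity is essential here: a head 0 raised twice would become 2.
  disjoint {c′ = zero ∷ _} _ ((() ∷ _ , _) , _) _
  disjoint {c′ = suc _ ∷ _} _ _ ()
  prepend : ∀ {c} → U n c → U (suc (suc n)) (2 ∷ c)
  prepend ((pos , eq) , even) = (s≤s z≤n ∷ pos , cong (_+_ 2) eq) ,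
    λ { zero _ → ∣-refl ; (suc i) (s≤s i<) → even i i< }
  increase : ∀ {c} → U n c → U (suc (suc n)) (incHead (incHead c))
  increase {_ ∷ _} ((_ ∷ pos , eq) , even) = (s≤s z≤n ∷ pos , cong (_+_ 2) eq) ,
    λ { zero i< → ∣m∣n⇒∣m+n ∣-refl (even zero i<) ; (suc i) i< → even (suc i) i< }
  split : ∀ {c} → U (suc (suc n)) c →
          (∃ λ c′ → U n c′ × c ≡ 2 ∷ c′) ⊎ (∃ λ c′ → U n c′ × c ≡ incHead (incHead c′))
  split {[]} ((_ , ()) , _)
  split {zero ∷ _} ((() ∷ _ , _) , _)
  split {suc zero ∷ []} ((_ , ()) , _)
  split {suc zero ∷ _ ∷ _} (_ , even) = ⊥-elim (¬InitEven-1∷ even)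
  split {suc (suc zero) ∷ c} ((_ ∷ pos , eq) , even) =
    inj₁ (c , ((pos , ℕ.+-cancelˡ-≡ 2 _ _ eq) , λ i i< → even (suc i) (s≤s i<)) , refl)
  split {suc (suc (suc x)) ∷ c} ((_ ∷ pos , eq) , even) =
    inj₂ (suc x ∷ c , ((s≤s z≤n ∷ pos , ℕ.+-cancelˡ-≡ 2 _ _ eq) ,
      λ { zero i< → ∣m+n∣m⇒∣n (even zero i<) ∣-refl ; (suc i) i< → even (suc i) i< }) , refl)

card-U : ∀ n → card (U-finite n) ≡ tails n
card-U zero          = refl
card-U (suc zero)    = refl
card-U (suc (suc n)) = trans
  (length-maps (2 ∷_) (incHead ∘ incHead) (Finite.elements (U-finite n)) _)
  (cong₂ _+_ (card-U n) (card-U n))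

-- The first part is not internal, so lowering it by 1 respects the condition. Deleting a leading 1
-- makes the second part first, yet it must stay even unless it is last; hence `U`.
E-finite : ∀ n → Finite (Cᵢₑ n)
E-finite zero = finite-singleton [] (([] , refl) , λ ()) (Composition-zero ∘ proj₁)
E-finite (suc zero) =
  finite-singleton (1 ∷ []) ((s≤s z≤n ∷ [] , refl) , λ { zero () })
    (Composition-one ∘ proj₁)
E-finite (suc (suc n)) =
  finite-⊎ (1 ∷_) incHead (U-finite n) (E-finite (suc n))
    ∷-injectiveʳ incHead-injective disjoint prepend increase split
  where
  disjoint : ∀ {c c′} → U n c → Cᵢₑ (suc n) c′ → 1 ∷ c ≢ incHead c′
  disjoint {c′ = zero ∷ _} _ ((() ∷ _ , _) , _) _
  disjoint {c′ = suc _ ∷ _} _ _ ()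
  prepend : ∀ {c} → U n c → Cᵢₑ (suc (suc n)) (1 ∷ c)
  prepend ((pos , eq) , even) = (s≤s z≤n ∷ pos , cong suc eq) ,
    λ { zero () _ ; (suc i) _ (s≤s i<) → even i i< }
  increase : ∀ {c} → Cᵢₑ (suc n) c → Cᵢₑ (suc (suc n)) (incHead c)
  increase {_ ∷ _} ((_ ∷ pos , eq) , even) = (s≤s z≤n ∷ pos , cong suc eq) ,
    λ { zero () _ ; (suc i) 0< i< → even (suc i) 0< i< }
  split : ∀ {c} → Cᵢₑ (suc (suc n)) c →
          (∃ λ c′ → U n c′ × c ≡ 1 ∷ c′) ⊎ (∃ λ c′ → Cᵢₑ (suc n) c′ × c ≡ incHead c′)
  split {[]} ((_ , ()) , _)
  split {zero ∷ _} ((() ∷ _ , _) , _)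
  split {suc zero ∷ c} ((_ ∷ pos , eq) , even) =
    inj₁ (c , ((pos , ℕ.suc-injective eq) , λ i i< → even (suc i) (s≤s z≤n) (s≤s i<)) , refl)
  split {suc (suc x) ∷ c} ((_ ∷ pos , eq) , even) =
    inj₂ (suc x ∷ c , ((s≤s z≤n ∷ pos , ℕ.suc-injective eq) ,
      λ { zero () _ ; (suc i) 0< i< → even (suc i) 0< i< }) , refl)

card-E : ∀ n → card (E-finite n) ≡ total n
card-E zero          = refl
card-E (suc zero)    = refl
card-E (suc (suc n)) = trans
  (length-maps (1 ∷_) incHead (Finite.elements (U-finite n)) _)
  (cong₂ _+_ (card-U n) (card-E (suc n)))

cᵢₑ≡total : ∀ n → cᵢₑ n ≡ total n
cᵢₑ≡total n = trans (card-cong (Cᵢₑ-finite n) (E-finite n) id id) (card-E n)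

-- Solving the recurrence

numerator denominator : PowerSeries
numerator   = poly (+ 1 ∷ + 0 ∷ - (+ 1) ∷ + 1 ∷ [])
denominator = poly (+ 1 ∷ - (+ 1) ∷ - (+ 2) ∷ + 2 ∷ [])

-- The denominator has degree 3, so only the last four terms of the convolution survive; the
-- induction strips the vanishing ones from the front.
⊛-denominator : ∀ h n → (h ⊛ denominator) (3 + n) ≡
  h n ℤ.* + 2 ℤ.+ (h (1 + n) ℤ.* - (+ 2) ℤ.+ (h (2 + n) ℤ.* - (+ 1) ℤ.+ h (3 + n) ℤ.* + 1))
⊛-denominator h zero    = refl
⊛-denominator h (suc n) = trans
  (cong₂ ℤ._+_ (ℤ.*-zeroʳ (h 0)) (⊛-denominator (h ∘ suc) n)) (ℤ.+-identityˡ _)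

total-series : generatingFunction total ⊛ denominator ≗ numerator
total-series 0 = refl
total-series 1 = refl
total-series 2 = refl
total-series 3 = refl
-- From index 4 on, all four values of `total` unfold to combinations of `total (suc n)`, `tails n`
-- and `tails (suc n)`, which cancel.
total-series (suc (suc (suc (suc n)))) =
  trans (⊛-denominator (generatingFunction total) (suc n))
        (cancel (+ total (suc n)) (+ tails n) (+ tails (suc n)))
  where
  cancel : ∀ a t u →
    a ℤ.* + 2 ℤ.+ ((t ℤ.+ a) ℤ.* - (+ 2) ℤ.+ ((u ℤ.+ (t ℤ.+ a)) ℤ.* - (+ 1)
      ℤ.+ ((t ℤ.+ t) ℤ.+ (u ℤ.+ (t ℤ.+ a))) ℤ.* + 1)) ≡ 0ℤ
  cancel = solve-∀

-- Closed forms

tails-even : ∀ k → tails (2 * k) ≡ 2 ^ k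
tails-even zero = refl
tails-even (suc k) rewrite ℕ.*-suc 2 k | tails-even k =
  cong (_+_ (2 ^ k)) (sym (ℕ.+-identityʳ (2 ^ k)))

tails-odd : ∀ k → tails (1 + 2 * k) ≡ 2 ^ k
tails-odd zero = refl
tails-odd (suc k) rewrite ℕ.+-suc k (k + 0) | tails-odd k =
  cong (_+_ (2 ^ k)) (sym (ℕ.+-identityʳ (2 ^ k)))

-- Adding 1 avoids truncated subtraction and preserves the recurrence for `total`. Each parity is
-- derived from the other at the preceding index.
total-odd  : ∀ k → suc (total (1 + 2 * k)) ≡ 2 ^ suc k
total-even : ∀ k → suc (total (2 + 2 * k)) ≡ 3 * 2 ^ k

total-odd zero = refl
total-odd (suc k) = begin
  suc (total (1 + 2 * suc k))                   ≡⟨ cong (suc ∘ total ∘ suc) (ℕ.*-suc 2 k) ⟩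
  suc (tails (1 + 2 * k) + total (2 + 2 * k))   ≡⟨ ℕ.+-suc (tails (1 + 2 * k)) _ ⟨
  tails (1 + 2 * k) + suc (total (2 + 2 * k))   ≡⟨ cong₂ _+_ (tails-odd k) (total-even k) ⟩
  2 ^ k + 3 * 2 ^ k                             ≡⟨ quadruple (2 ^ k) ⟩
  2 ^ suc (suc k)                               ∎
  where
  open ≡-Reasoning
  quadruple : ∀ x → x + 3 * x ≡ 2 * (2 * x)
  quadruple = ℕ-Solver.solve-∀

total-even k = begin
  suc (tails (2 * k) + total (1 + 2 * k))       ≡⟨ ℕ.+-suc (tails (2 * k)) _ ⟨
  tails (2 * k) + suc (total (1 + 2 * k))       ≡⟨ cong₂ _+_ (tails-even k) (total-odd k) ⟩
  -- This agrees with `3 * 2 ^ k` by computation.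
  2 ^ k + 2 ^ suc k                             ∎
  where open ≡-Reasoning

theorem2p5 : (∀ n → d n ≡ cᵢₑ n)
    × (generatingFunction d ≗
    quotient (poly (+ 1 ∷ + 0 ∷ - (+ 1) ∷ + 1 ∷ []))
    (poly (+ 1 ∷ - (+ 1) ∷ - (+ 2) ∷ + 2 ∷ []))
    refl)
    × (∀ n m → 1 ≤ n →
    (n ≡ 2 * m ∸ 1 → d n ≡ 2 ^ m ∸ 1)
    × (n ≡ 2 * m → d n ≡ 3 * 2 ^ (m ∸ 1) ∸ 1))
theorem2p5 = (λ n → trans (d≡total n) (sym (cᵢₑ≡total n))) , series , closed-form
  where
  series : generatingFunction d ≗ quotient numerator denominator refl
  series n = trans (cong +_ (d≡total n))
    (quotient-unique (generatingFunction total) numerator denominator refl total-series n)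
  closed-form : ∀ n m → 1 ≤ n →
    (n ≡ 2 * m ∸ 1 → d n ≡ 2 ^ m ∸ 1) × (n ≡ 2 * m → d n ≡ 3 * 2 ^ (m ∸ 1) ∸ 1)
  -- For m = 0 either hypothesis would force n = 0.
  closed-form (suc _) zero    _ = (λ ()) , (λ ())
  closed-form n       (suc m) _ =
    (λ n≡ → trans (d≡total n) (cong (_∸ 1) (trans
      (cong (suc ∘ total) (trans n≡ (cong (_∸ 1) (ℕ.*-suc 2 m)))) (total-odd m)))) ,
    (λ n≡ → trans (d≡total n) (cong (_∸ 1) (trans
      (cong (suc ∘ total) (trans n≡ (ℕ.*-suc 2 m))) (total-even m))))
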